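{- There exists an infinite word over a 2-letter alphabet that simultaneously avoids the five formulas with reversal $xyzyx\cdot zyxy^Rz$, $xyzyx\cdot zy^Rxyz$, $xyzyx\cdot zy^Rxy^Rz$, $xyzy^Rx\cdot zyxy^Rz$, and $xyzy^Rx\cdot zy^Rxyz$.
   Context: A formula with reversal is a finite set of words (called fragments, written separated by dots) over an alphabet of variables, where each variable $x$ may occur either as $x$ or as $x^R$. An occurrence of a formula with reversal $F$ in a word $w$ is a map $h$ assigning to each variable a nonempty word, extended to fragments by concatenation with the convention $h(x^R)=h(x)^R$ (the reverse, i.e. mirror image, of $h(x)$), such that $h(f)$ is a factor of $w$ for every fragment $f$ of $F$. A word avoids $F$ if it contains no occurrence of $F$. -}

module Defs where

open import Data.Nat using (ℕ; suc)
open import Data.Bool using (Bool)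
open import Data.List using (List; []; _∷_; _++_; reverse; concatMap)
open import Data.Product using (_×_; ∃)
open import Data.Unit using (⊤)
open import Data.Empty using (⊥)
open import Relation.Binary.PropositionalEquality using (_≡_; _≢_)
open import Data.List.Relation.Unary.All using (All)

InfWord : Set
InfWord = ℕ → Bool

data Var : Set where
  x y z : Var

-- A letter of a fragment: a variable, either plain or reversed (x^R).
data Lit : Set where
  +_ : Var → Lit
  R_ : Var → Lit

Fragment : Set
Fragment = List Lit

Formula : Set
Formula = List Fragment

Assignment : Set
Assignment = Var → List Bool

NonEmptyAssignment : Assignment → Set
NonEmptyAssignment h = (v : Var) → h v ≢ []

applyLit : Assignment → Lit → List Bool
applyLit h (+ v) = h v
applyLit h (R v) = reverse (h v)

applyFrag : Assignment → Fragment → List Bool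
applyFrag h f = concatMap (applyLit h) f

OccursAt : InfWord → ℕ → List Bool → Set
OccursAt w i [] = ⊤
OccursAt w i (a ∷ u) = (w i ≡ a) × OccursAt w (suc i) u

Factor : List Bool → InfWord → Set
Factor u w = ∃ λ i → OccursAt w i u

IsOccurrence : Formula → InfWord → Assignment → Set
IsOccurrence F w h = NonEmptyAssignment h × All (λ f → Factor (applyFrag h f) w) F

Avoids : InfWord → Formula → Set
Avoids w F = (h : Assignment) → IsOccurrence F w h → ⊥

F1 : Formula
F1 = (+ x ∷ + y ∷ + z ∷ + y ∷ + x ∷ []) ∷ (+ z ∷ + y ∷ + x ∷ R y ∷ + z ∷ []) ∷ []
F2 : Formula
F2 = (+ x ∷ + y ∷ + z ∷ + y ∷ + x ∷ []) ∷ (+ z ∷ R y ∷ + x ∷ + y ∷ + z ∷ []) ∷ []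
F3 : Formula
F3 = (+ x ∷ + y ∷ + z ∷ + y ∷ + x ∷ []) ∷ (+ z ∷ R y ∷ + x ∷ R y ∷ + z ∷ []) ∷ []
F4 : Formula
F4 = (+ x ∷ + y ∷ + z ∷ R y ∷ + x ∷ []) ∷ (+ z ∷ + y ∷ + x ∷ R y ∷ + z ∷ []) ∷ []
F5 : Formula
F5 = (+ x ∷ + y ∷ + z ∷ R y ∷ + x ∷ []) ∷ (+ z ∷ R y ∷ + x ∷ + y ∷ + z ∷ []) ∷ []

{-# OPTIONS --safe #-}
module Submission where

-- In each formula y occurs both plain and reversed.  We take w = g(t), where t is the fixed point of a
-- 12-uniform morphism on five letters and g is 139-uniform, chosen such that no factor of w of length 11 has
-- its reversal as a factor; hence |y| ≤ 10.  Up to the copies of y, the two fragments are x _ z _ x and z _ x _ z,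
-- both of period |x| + |z| + 2|y|.  If x or z is at least as long as the synchronisation delay of g, this period
-- is a multiple of 139 and the two fragments are aligned in the same way with the blocks of g.  Cutting each
-- gap at a block boundary yields words X, Z, not both empty, such that XZX and ZXZ are factors of t.  The same
-- argument with empty gaps turns such a pair in t into a shorter one, until |X|, |Z| ≤ 9.  What remains on both
-- levels is a finite check.

open import Defs using (InfWord; Avoids; OccursAt; F1; F2; F3; F4; F5)
import Defs
open import Data.Bool using (Bool; true; false; _∧_; _∨_; not; _xor_; if_then_else_)
open import Data.Bool.ListAction using (all; any)
import Data.Bool.Properties as Bool
open import Data.Empty using (⊥; ⊥-elim)
open import Data.Fin using (Fin; toℕ)
open import Data.Fin.Patterns
import Data.Fin.Properties as Fin
open import Data.List using (List; []; _∷_; _++_; map; concatMap; take; drop; length; reverse; foldr; allFin; upTo; cartesianProduct)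
open import Data.List.Properties
open import Data.List.Membership.Propositional using (_∈_; lose)
open import Data.List.Membership.Propositional.Properties using (∈-allFin; ∈-upTo⁺; ∈-concatMap⁺; ∈-cartesianProduct⁺)
import Data.List.Membership.DecPropositional as DecMembership
open import Data.List.Relation.Unary.All using (_∷_; [])
open import Data.List.Relation.Unary.Any using (here; there)
open import Data.Nat
open import Data.Nat.Divisibility using (_∣_; divides; ∣⇒≤)
open import Data.Nat.DivMod
open import Data.Nat.Induction using (<-rec)
open import Data.Nat.Properties
open import Data.Nat.Tactic.RingSolver using (solve-∀)
open import Data.Product using (_×_; _,_; ∃; ∃₂; proj₁; proj₂)
open import Data.Sum using (_⊎_; inj₁; inj₂)
open import Data.Unit using (tt)
open import Function using (_∘_; case_of_)
open import Relation.Binary.Definitions using (DecidableEquality)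
open import Relation.Binary.PropositionalEquality
open import Relation.Nullary using (Dec; yes; no; does)

-- Descent along a uniform morphism

Match : {A : Set} → (ℕ → A) → ℕ → ℕ → ℕ → Set
Match w i j n = ∀ q → q < n → w (i + q) ≡ w (j + q)

-- x (length n) and z (length m) occur as x _ z _ x at i and as z _ x _ z at j, where every gap between x and z
-- has length k₁ and every gap between z and x has length k₂; the contents of the gaps are ignored.
record Occ {A : Set} (w : ℕ → A) (i j n m k₁ k₂ : ℕ) : Set where
  constructor occ
  field
    xx₁ : Match w i (i + (n + k₁ + m + k₂)) n
    xx₂ : Match w i (j + m + k₂) n
    zz₁ : Match w j (j + (m + k₂ + n + k₁)) m
    zz₂ : Match w j (i + n + k₁) m

swapOcc : ∀ {A : Set} {w : ℕ → A} {i j n m k₁ k₂} → Occ w i j n m k₁ k₂ → Occ w j i m n k₂ k₁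
swapOcc (occ a b c d) = occ c d a b

m<[1+m/n]*n : ∀ m n .{{_ : NonZero n}} → m < suc (m / n) * n
m<[1+m/n]*n m n = ≤-<-trans (≤-reflexive (m≡m%n+[m/n]*n m n)) (+-monoˡ-< (m / n * n) (m%n<n m n))

-- `M` is a synchronisation delay of the code; `s` is how many letters of a block suffice to
-- recognise its source letter once their offset in the block is known.
module Morphism {A B : Set} (L : ℕ) .{{_ : NonZero L}} (code : A → ℕ → B) (t : ℕ → A) (w : ℕ → B)
  (w-block : ∀ c r → r < L → w (c * L + r) ≡ code (t c) r)
  (s M : ℕ) (s≤L : s ≤ L) (0<s : 0 < s)
  (separated : ∀ a b r → r + s ≤ L → (∀ q → q < s → code a (r + q) ≡ code b (r + q)) → a ≡ b)
  (sync : ∀ i j → Match w i j M → i % L ≡ j % L)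
  where

  -- Block `d` is [dL, dL + L), and the hypotheses put at least `s` of its letters into the window
  -- [r, r + n). `separated` is applied to the first `s` letters of the overlap, which starts at dL
  -- or at r, whichever is larger.
  forced : ∀ I J r n d → Match w (I * L + r) (J * L + r) n → s ≤ n →
           r + s ≤ d * L + L → d * L + s ≤ r + n → t (I + d) ≡ t (J + d)
  forced I J r n d match s≤n lo hi with ≤-total r (d * L)
  ... | inj₁ r≤dL = separated _ _ 0 s≤L λ q q<s → trans (sym (w-block (I + d) q (<-≤-trans q<s s≤L)))
                     (trans (trans (cong w (pos I q)) (trans (match (o + q) (in-range q q<s)) (cong w (sym (pos J q)))))
                     (w-block (J + d) q (<-≤-trans q<s s≤L)))
    where
    o = d * L ∸ r
    ro : r + o ≡ d * L
    ro = m+[n∸m]≡n r≤dL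
    pos : ∀ I q → (I + d) * L + q ≡ (I * L + r) + (o + q)
    pos I q = trans (cong (_+ q) (trans (*-distribʳ-+ L I d) (cong (I * L +_) (sym ro)))) (lem (I * L) r o q)
      where lem : ∀ a b c d → a + (b + c) + d ≡ a + b + (c + d)
            lem = solve-∀
    in-range : ∀ q → q < s → o + q < n
    in-range q q<s = +-cancelˡ-< r _ _ (<-≤-trans (≤-reflexive (cong suc (trans (sym (+-assoc r o q)) (cong (_+ q) ro)))) (≤-trans (≤-reflexive (sym (+-suc (d * L) q))) (≤-trans (+-monoʳ-≤ (d * L) q<s) hi)))
  ... | inj₂ dL≤r = separated _ _ o o+s≤L λ q q<s → trans (sym (w-block (I + d) (o + q) (in-block q q<s)))
                     (trans (trans (cong w (pos I q)) (trans (match q (<-≤-trans q<s s≤n)) (cong w (sym (pos J q)))))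
                     (w-block (J + d) (o + q) (in-block q q<s)))
    where
    o = r ∸ d * L
    ro : d * L + o ≡ r
    ro = m+[n∸m]≡n dL≤r
    o+s≤L : o + s ≤ L
    o+s≤L = +-cancelˡ-≤ (d * L) _ _ (≤-trans (≤-reflexive (trans (sym (+-assoc (d * L) o s)) (cong (_+ s) ro))) lo)
    in-block : ∀ q → q < s → o + q < L
    in-block q q<s = <-≤-trans (+-monoʳ-< o q<s) o+s≤L
    pos : ∀ I q → (I + d) * L + (o + q) ≡ (I * L + r) + q
    pos I q = trans (cong (_+ (o + q)) (*-distribʳ-+ L I d)) (trans (lem (I * L) (d * L) o q) (cong (λ □ → I * L + □ + q) ro))
      where lem : ∀ a b c d → a + b + (c + d) ≡ a + (b + c) + d
            lem = solve-∀

  -- With L = s + k + h, the blocks from (r + h) / L up to (r + n + k + h) / L meet the window [r, r + n) in at least s letters.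
  equal-long-blocks : ∀ I J r n k h d → s + k + h ≡ L → s ≤ suc h → Match w (I * L + r) (J * L + r) n → s ≤ n →
           (r + h) / L ≤ d → d < (r + n + (k + h)) / L → t (I + d) ≡ t (J + d)
  equal-long-blocks I J r n k h d eq s≤1+h match s≤n lo hi = forced I J r n d match s≤n
      (begin
        r + s             ≤⟨ +-monoʳ-≤ r s≤1+h ⟩
        r + suc h         ≡⟨ +-suc r h ⟩
        suc (r + h)       ≤⟨ m<[1+m/n]*n (r + h) L ⟩
        suc ((r + h) / L) * L ≤⟨ *-monoˡ-≤ L (s≤s lo) ⟩
        suc d * L         ≡⟨ +-comm L (d * L) ⟩
        d * L + L         ∎)
      (+-cancelʳ-≤ (k + h) _ _ (begin
        d * L + s + (k + h)              ≡⟨ trans (+-assoc (d * L) s (k + h)) (cong (d * L +_) (trans (sym (+-assoc s k h)) eq)) ⟩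
        d * L + L                        ≡⟨ +-comm (d * L) L ⟩
        suc d * L                        ≤⟨ *-monoˡ-≤ L hi ⟩
        ((r + n + (k + h)) / L) * L      ≤⟨ m/n*n≤m (r + n + (k + h)) L ⟩
        r + n + (k + h)                  ∎))
    where open ≤-Reasoning

  -- The second case admits an empty word: with no letters and no gap, the range of blocks in
  -- `equal-blocks` is empty.
  Long : ℕ → ℕ → Set
  Long n k = s ≤ n ⊎ (n ≡ 0 × k ≡ 0)

  equal-blocks : ∀ I J r n k h d → s + k + h ≡ L → s ≤ suc h → Match w (I * L + r) (J * L + r) n → Long n k →
           (r + h) / L ≤ d → d < (r + n + (k + h)) / L → t (I + d) ≡ t (J + d)
  equal-blocks I J r n k h d eq s≤ match (inj₁ s≤n) lo hi = equal-long-blocks I J r n k h d eq s≤ match s≤n lo hi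
  equal-blocks I J r .0 .0 h d eq s≤ match (inj₂ (refl , refl)) lo hi =
    ⊥-elim (<-irrefl refl (≤-<-trans lo (subst (λ □ → d < (□ + h) / L) (+-identityʳ r) hi)))

  [a*L+b]/L : ∀ a b → (a * L + b) / L ≡ a + b / L
  [a*L+b]/L a b = trans (+-distrib-/-∣ˡ b (divides a refl)) (cong (_+ b / L) (m*n/n≡m a L))

  -- The gap between x and z is cut at the block boundary b = u + a′, the one between z and x at b′ = v + a.
  descend-aligned : ∀ I J r ρ v u n m k₁ k₂ h₁ h₂ →
    s + k₁ + h₁ ≡ L → s ≤ suc h₁ → s + k₂ + h₂ ≡ L → s ≤ suc h₂ →
    ρ + m + k₂ ≡ v * L + r → r + n + k₁ ≡ u * L + ρ → Long n k₂ → Long m k₁ →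
    Occ w (I * L + r) (J * L + ρ) n m k₁ k₂ →
    ∃₂ λ i j → ∃₂ λ n′ m′ → n′ + m′ ≡ u + v × Occ t i j n′ m′ 0 0
  descend-aligned I J r ρ v u n m k₁ k₂ h₁ h₂ e₁ l₁ e₂ l₂ ev eu long-n long-m (occ xx₁ xx₂ zz₁ zz₂) =
    I + a , J + a′ , b ∸ a , b′ ∸ a′ , sum ,
    occ (range a b x-blocks₁ to₁) (range a b x-blocks₂ to₂) (range a′ b′ z-blocks₁ to₃) (range a′ b′ z-blocks₂ to₄)
    where
    a = (r + h₂) / L
    a′ = (ρ + h₁) / L
    b = (r + n + (k₂ + h₂)) / L
    b′ = (ρ + m + (k₁ + h₁)) / L
    -- Both sums are L - s. As z starts `k₁` letters after x ends, adding L - s at the end of x or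
    -- `h₁` at the start of z gives the same number. So the blocks credited to x stop exactly where
    -- those credited to z start, and likewise from z to x.
    k+h : k₂ + h₂ ≡ k₁ + h₁
    k+h = +-cancelˡ-≡ s _ _ (trans (sym (+-assoc s k₂ h₂)) (trans e₂ (trans (sym e₁) (+-assoc s k₁ h₁))))
    b≡ : b ≡ u + a′
    b≡ = trans (cong (_/ L) (trans (cong (r + n +_) k+h) (trans (sym (+-assoc (r + n) k₁ h₁))
           (trans (cong (_+ h₁) eu) (+-assoc (u * L) ρ h₁))))) ([a*L+b]/L u (ρ + h₁))
    b′≡ : b′ ≡ v + a
    b′≡ = trans (cong (_/ L) (trans (cong (ρ + m +_) (sym k+h)) (trans (sym (+-assoc (ρ + m) k₂ h₂))
           (trans (cong (_+ h₂) ev) (+-assoc (v * L) r h₂))))) ([a*L+b]/L v (r + h₂))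
    a≤b : a ≤ b
    a≤b = /-monoˡ-≤ L (+-mono-≤ (m≤m+n r n) (m≤n+m h₂ k₂))
    a′≤b′ : a′ ≤ b′
    a′≤b′ = /-monoˡ-≤ L (+-mono-≤ (m≤m+n ρ m) (m≤n+m h₁ k₁))
    a+n′ : a + (b ∸ a) ≡ u + a′
    a+n′ = trans (m+[n∸m]≡n a≤b) b≡
    a′+m′ : a′ + (b′ ∸ a′) ≡ v + a
    a′+m′ = trans (m+[n∸m]≡n a′≤b′) b′≡
    sum : (b ∸ a) + (b′ ∸ a′) ≡ u + v
    sum = +-cancelˡ-≡ (a + a′) _ _ (trans (lem₁ a a′ (b ∸ a) (b′ ∸ a′)) (trans (cong₂ _+_ a+n′ a′+m′) (lem₂ u a′ v a)))
      where lem₁ : ∀ a b c d → a + b + (c + d) ≡ (a + c) + (b + d)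
            lem₁ = solve-∀
            lem₂ : ∀ u b v a → u + b + (v + a) ≡ a + b + (u + v)
            lem₂ = solve-∀
    -- Passing x and then z composes the two alignments, so the period is `u + v` whole blocks.
    period : r + (n + k₁ + m + k₂) ≡ (u + v) * L + r
    period = trans (lem₁ r n k₁ m k₂) (trans (cong (λ □ → □ + m + k₂) eu) (trans (lem₂ (u * L) ρ m k₂)
               (trans (cong (u * L +_) ev) (lem₃ u v L r))))
      where lem₁ : ∀ r n k m l → r + (n + k + m + l) ≡ r + n + k + m + l
            lem₁ = solve-∀
            lem₂ : ∀ a b c d → a + b + c + d ≡ a + (b + c + d)
            lem₂ = solve-∀
            lem₃ : ∀ u v l r → u * l + (v * l + r) ≡ (u + v) * l + r
            lem₃ = solve-∀
    period′ : ρ + (m + k₂ + n + k₁) ≡ (u + v) * L + ρ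
    period′ = trans (lem₁ ρ m k₂ n k₁) (trans (cong (λ □ → □ + n + k₁) ev) (trans (lem₂ (v * L) r n k₁)
               (trans (cong (v * L +_) eu) (lem₃ u v L ρ))))
      where lem₁ : ∀ r n k m l → r + (n + k + m + l) ≡ r + n + k + m + l
            lem₁ = solve-∀
            lem₂ : ∀ a b c d → a + b + c + d ≡ a + (b + c + d)
            lem₂ = solve-∀
            lem₃ : ∀ u v l r → v * l + (u * l + r) ≡ (u + v) * l + r
            lem₃ = solve-∀
    shift : ∀ I c d e → d ≡ c * L + e → I * L + d ≡ (I + c) * L + e
    shift I c d e eq = trans (cong (I * L +_) eq) (trans (sym (+-assoc (I * L) (c * L) e)) (cong (_+ e) (sym (*-distribʳ-+ L I c))))
    at : ∀ {i j j′ l} → j ≡ j′ → Match w i j l → Match w i j′ l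
    at refl mt = mt
    x-blocks₁ : ∀ d → a ≤ d → d < b → t (I + d) ≡ t (I + (u + v) + d)
    x-blocks₁ d = equal-blocks I (I + (u + v)) r n k₂ h₂ d e₂ l₂ (at (trans (+-assoc (I * L) r _) (shift I (u + v) _ r period)) xx₁) long-n
    x-blocks₂ : ∀ d → a ≤ d → d < b → t (I + d) ≡ t (J + v + d)
    x-blocks₂ d = equal-blocks I (J + v) r n k₂ h₂ d e₂ l₂ (at (trans (assoc₃ (J * L) ρ m k₂) (shift J v _ r ev)) xx₂) long-n
      where assoc₃ : ∀ a b c d → a + b + c + d ≡ a + (b + c + d)
            assoc₃ = solve-∀
    z-blocks₁ : ∀ d → a′ ≤ d → d < b′ → t (J + d) ≡ t (J + (u + v) + d)
    z-blocks₁ d = equal-blocks J (J + (u + v)) ρ m k₁ h₁ d e₁ l₁ (at (trans (+-assoc (J * L) ρ _) (shift J (u + v) _ ρ period′)) zz₁) long-m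
    z-blocks₂ : ∀ d → a′ ≤ d → d < b′ → t (J + d) ≡ t (I + u + d)
    z-blocks₂ d = equal-blocks J (I + u) ρ m k₁ h₁ d e₁ l₁ (at (trans (assoc₃ (I * L) r n k₁) (shift I u _ ρ eu)) zz₂) long-m
      where assoc₃ : ∀ a b c d → a + b + c + d ≡ a + (b + c + d)
            assoc₃ = solve-∀
    range : ∀ {I J K} a b → (∀ d → a ≤ d → d < b → t (I + d) ≡ t (J + d)) → K ≡ J + a → Match t (I + a) K (b ∸ a)
    range {I} {J} a b eqs refl q q<b∸a =
      trans (cong t (+-assoc I a q)) (trans (eqs (a + q) (m≤m+n a q)
        (<-≤-trans (+-monoʳ-< a q<b∸a) (≤-reflexive (m+[n∸m]≡n (<⇒≤ (m<n∸o⇒o<n b a (≤-<-trans z≤n q<b∸a)))))))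
        (sym (cong t (+-assoc J a q))))
      where
      m<n∸o⇒o<n : ∀ b a → 0 < b ∸ a → a < b
      m<n∸o⇒o<n b a p = ≰⇒> λ b≤a → <-irrefl refl (subst (0 <_) (m≤n⇒m∸n≡0 b≤a) p)
    to₁ : I + a + ((b ∸ a) + 0 + (b′ ∸ a′) + 0) ≡ I + (u + v) + a
    to₁ = trans (lem₁ I a (b ∸ a) (b′ ∸ a′)) (cong (λ □ → I + □ + a) sum)
      where lem₁ : ∀ I a n m → I + a + (n + 0 + m + 0) ≡ I + (n + m) + a
            lem₁ = solve-∀
    to₂ : J + a′ + (b′ ∸ a′) + 0 ≡ J + v + a
    to₂ = trans (lem₁ J a′ (b′ ∸ a′)) (trans (cong (J +_) a′+m′) (sym (+-assoc J v a)))
      where lem₁ : ∀ J a m → J + a + m + 0 ≡ J + (a + m)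
            lem₁ = solve-∀
    to₃ : J + a′ + ((b′ ∸ a′) + 0 + (b ∸ a) + 0) ≡ J + (u + v) + a′
    to₃ = trans (lem₁ J a′ (b ∸ a) (b′ ∸ a′)) (cong (λ □ → J + □ + a′) sum)
      where lem₁ : ∀ I a n m → I + a + (m + 0 + n + 0) ≡ I + (n + m) + a
            lem₁ = solve-∀
    to₄ : I + a + (b ∸ a) + 0 ≡ I + u + a′
    to₄ = trans (lem₁ I a (b ∸ a)) (trans (cong (I +_) a+n′) (sym (+-assoc I u a′)))
      where lem₁ : ∀ J a m → J + a + m + 0 ≡ J + (a + m)
            lem₁ = solve-∀

  %-cancelʳ : ∀ {a b} c → a ≤ b → b < L → (a + c) % L ≡ (b + c) % L → a ≡ b
  %-cancelʳ {a} {b} c a≤b b<L eq = ≤-antisym a≤b (m∸n≡0⇒m≤n (small-multiple (b ∸ a) (≤-<-trans (m∸n≤m b a) b<L) L∣b∸a))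
    where
    small-multiple : ∀ d → d < L → L ∣ d → d ≡ 0
    small-multiple zero _ _ = refl
    small-multiple (suc d) d<L L∣d = ⊥-elim (<-irrefl refl (<-≤-trans d<L (∣⇒≤ L∣d)))
    Q = (a + c) / L
    Q′ = (b + c) / L
    R = (a + c) % L
    b+c : b + c ≡ R + Q′ * L
    b+c = trans (m≡m%n+[m/n]*n (b + c) L) (cong (_+ Q′ * L) (sym eq))
    L∣b∸a : L ∣ b ∸ a
    L∣b∸a = divides (Q′ ∸ Q) (begin
      b ∸ a                       ≡⟨ sym ([m+n]∸[m+o]≡n∸o c b a) ⟩
      (c + b) ∸ (c + a)           ≡⟨ cong₂ _∸_ (trans (+-comm c b) b+c) (trans (+-comm c a) (m≡m%n+[m/n]*n (a + c) L)) ⟩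
      (R + Q′ * L) ∸ (R + Q * L)  ≡⟨ [m+n]∸[m+o]≡n∸o R (Q′ * L) (Q * L) ⟩
      Q′ * L ∸ Q * L              ≡⟨ sym (*-distribʳ-∸ L Q′ Q) ⟩
      (Q′ ∸ Q) * L                ∎)
      where open ≡-Reasoning

  divMod : ∀ e → e ≡ e / L * L + e % L
  divMod e = trans (m≡m%n+[m/n]*n e L) (+-comm (e % L) (e / L * L))

  %-+ˡ : ∀ e c → (e % L + c) % L ≡ (e + c) % L
  %-+ˡ e c = trans (sym ([m+kn]%n≡m%n (e % L + c) (e / L) L)) (cong (_% L) (trans (lem (e % L) c (e / L * L)) (cong (_+ c) (sym (m≡m%n+[m/n]*n e L)))))
    where lem : ∀ a b c → a + b + c ≡ a + c + b
          lem = solve-∀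

  -- With p the period, synchronising the two matches of x gives r ≡ r + p and r ≡ ρ + m + k₂ modulo
  -- L; cancelling m + k₂ yields r + n + k₁ ≡ ρ, so the alignment of z follows from that of x. The
  -- bounds 2s + k ≤ L + 1 mean that a block keeps at least 2s - 1 letters outside a gap of length
  -- k, hence at least s on one side of it.
  descend : ∀ i j n m k₁ k₂ → 2 * s + k₁ ≤ suc L → 2 * s + k₂ ≤ suc L → s ≤ M → M ≤ n → Long m k₁ → Occ w i j n m k₁ k₂ →
    ∃₂ λ i′ j′ → ∃₂ λ n′ m′ → (n′ + m′) * L ≡ n + k₁ + m + k₂ × Occ t i′ j′ n′ m′ 0 0
  descend i j n m k₁ k₂ gap₁ gap₂ s≤M M≤n long-m o@(occ xx₁ xx₂ _ _) =
    let i′ , j′ , n′ , m′ , sum , o′ = descend-aligned (i / L) (j / L) r ρ v u n m k₁ k₂ h₁ h₂ (L≡ k₁ gap₁) (h≥ k₁ gap₁) (L≡ k₂ gap₂) (h≥ k₂ gap₂)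
              ρ≡ r≡ (inj₁ (≤-trans s≤M M≤n)) long-m (subst₂ (λ i j → Occ w i j n m k₁ k₂) (divMod i) (divMod j) o)
    in i′ , j′ , n′ , m′ , trans (cong (_* L) sum) total , o′
    where
    r = i % L
    ρ = j % L
    h₁ = L ∸ (s + k₁)
    h₂ = L ∸ (s + k₂)
    u = (r + n + k₁) / L
    v = (ρ + m + k₂) / L
    p = n + k₁ + m + k₂
    2s : ∀ k → 2 * s + k ≡ s + (s + k)
    2s k = lem s k
      where lem : ∀ s k → 2 * s + k ≡ s + (s + k)
            lem = solve-∀
    s+k≤L : ∀ k → 2 * s + k ≤ suc L → s + k ≤ L
    s+k≤L k gap = s≤s⁻¹ (≤-trans (+-monoˡ-≤ (s + k) 0<s) (≤-trans (≤-reflexive (sym (2s k))) gap))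
    L≡ : ∀ k → 2 * s + k ≤ suc L → s + k + (L ∸ (s + k)) ≡ L
    L≡ k gap = m+[n∸m]≡n (s+k≤L k gap)
    h≥ : ∀ k → 2 * s + k ≤ suc L → s ≤ suc (L ∸ (s + k))
    h≥ k gap = +-cancelˡ-≤ (s + k) _ _ (≤-trans (≤-reflexive (trans (+-comm (s + k) s) (sym (2s k)))) (≤-trans gap
      (≤-reflexive (sym (trans (+-suc (s + k) _) (cong suc (L≡ k gap)))))))
    sync-x₁ : r ≡ (i + p) % L
    sync-x₁ = sync i (i + p) λ q q<M → xx₁ q (<-≤-trans q<M M≤n)
    sync-x₂ : r ≡ (ρ + (m + k₂)) % L
    sync-x₂ = trans (sync i (j + m + k₂) λ q q<M → xx₂ q (<-≤-trans q<M M≤n))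
              (trans (cong (_% L) (+-assoc j m k₂)) (sym (%-+ˡ j (m + k₂))))
    ρ≡ : ρ + m + k₂ ≡ v * L + r
    ρ≡ = trans (divMod (ρ + m + k₂)) (cong (v * L +_) (trans (cong (_% L) (+-assoc ρ m k₂)) (sym sync-x₂)))
    ρ′ = (r + n + k₁) % L
    ρ′-sync : (ρ′ + (m + k₂)) % L ≡ (ρ + (m + k₂)) % L
    ρ′-sync = trans (%-+ˡ (r + n + k₁) (m + k₂)) (trans (cong (_% L) (lem r n k₁ m k₂)) (trans (%-+ˡ i p) (trans (sym sync-x₁) sync-x₂)))
      where lem : ∀ r n k m l → r + n + k + (m + l) ≡ r + (n + k + m + l)
            lem = solve-∀
    ρ′≡ρ : ρ′ ≡ ρ
    ρ′≡ρ with ≤-total ρ′ ρ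
    ... | inj₁ le = %-cancelʳ (m + k₂) le (m%n<n j L) ρ′-sync
    ... | inj₂ ge = sym (%-cancelʳ (m + k₂) ge (m%n<n (r + n + k₁) L) (sym ρ′-sync))
    r≡ : r + n + k₁ ≡ u * L + ρ
    r≡ = trans (divMod (r + n + k₁)) (cong (u * L +_) ρ′≡ρ)
    total : (u + v) * L ≡ p
    total = +-cancelˡ-≡ (r + ρ) _ _ (sym (trans (lem₁ r ρ n k₁ m k₂) (trans (cong₂ _+_ r≡ ρ≡) (lem₂ u v L r ρ))))
      where lem₁ : ∀ r ρ n k m l → r + ρ + (n + k + m + l) ≡ r + n + k + (ρ + m + l)
            lem₁ = solve-∀
            lem₂ : ∀ u v l r ρ → u * l + ρ + (v * l + r) ≡ r + ρ + (u + v) * l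
            lem₂ = solve-∀

-- Finite windows and Boolean tests on them

win : {A : Set} → (ℕ → A) → ℕ → ℕ → List A
win s i zero = []
win s i (suc n) = s i ∷ win s (suc i) n

length-win : ∀ {A : Set} (s : ℕ → A) i n → length (win s i n) ≡ n
length-win s i zero = refl
length-win s i (suc n) = cong suc (length-win s (suc i) n)

win-++ : ∀ {A : Set} (s : ℕ → A) i m n → win s i (m + n) ≡ win s i m ++ win s (i + m) n
win-++ s i zero n = cong (λ □ → win s □ n) (sym (+-identityʳ i))
win-++ s i (suc m) n = cong (s i ∷_) (trans (win-++ s (suc i) m n) (cong (λ □ → win s (suc i) m ++ win s □ n) (sym (+-suc i m))))

win-Match : ∀ {A : Set} {s : ℕ → A} i j n → win s i n ≡ win s j n → Match s i j n
win-Match {s = s} i j (suc n) eq zero _ = trans (cong s (+-identityʳ i)) (trans (∷-injectiveˡ eq) (cong s (sym (+-identityʳ j))))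
win-Match {s = s} i j (suc n) eq (suc q) (s≤s q<n) =
  trans (cong s (+-suc i q)) (trans (win-Match (suc i) (suc j) n (∷-injectiveʳ eq) q q<n) (cong s (sym (+-suc j q))))

Match-win : ∀ {A : Set} {s s′ : ℕ → A} i j n → (∀ q → q < n → s (i + q) ≡ s′ (j + q)) → win s i n ≡ win s′ j n
Match-win i j zero match = refl
Match-win {s = s} {s′} i j (suc n) match = cong₂ _∷_
  (trans (cong s (sym (+-identityʳ i))) (trans (match 0 z<s) (cong s′ (+-identityʳ j))))
  (Match-win (suc i) (suc j) n λ q q<n → trans (cong s (sym (+-suc i q))) (trans (match (suc q) (s<s q<n)) (cong s′ (+-suc j q))))

take-win : ∀ {A : Set} (s : ℕ → A) i {k N} → k ≤ N → take k (win s i N) ≡ win s i k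
take-win s i z≤n = refl
take-win s i (s≤s k≤N) = cong (s i ∷_) (take-win s (suc i) k≤N)

drop-win : ∀ {A : Set} (s : ℕ → A) i n N → drop n (win s i N) ≡ win s (i + n) (N ∸ n)
drop-win s i zero N = cong (λ □ → win s □ N) (sym (+-identityʳ i))
drop-win s i (suc n) zero = refl
drop-win s i (suc n) (suc N) = trans (drop-win s (suc i) n N) (cong (λ □ → win s □ (N ∸ n)) (sym (+-suc i n)))

take-drop-win : ∀ {A : Set} (s : ℕ → A) i n k N → n + k ≤ N → take k (drop n (win s i N)) ≡ win s (i + n) k
take-drop-win s i n k N le = trans (cong (take k) (drop-win s i n N)) (take-win s (i + n) (m+n≤o⇒n≤o∸m n le))
  where
  m+n≤o⇒n≤o∸m : ∀ m {n o} → m + n ≤ o → n ≤ o ∸ m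
  m+n≤o⇒n≤o∸m m {n} {o} le = ≤-trans (≤-reflexive (sym (m+n∸m≡n m n))) (∸-monoˡ-≤ m le)

at : {A : Set} → A → List A → ℕ → A
at d [] n = d
at d (a ∷ u) zero = a
at d (a ∷ u) (suc n) = at d u n

win-at : ∀ {A : Set} (d : A) u → win (at d u) 0 (length u) ≡ u
win-at d [] = refl
win-at d (a ∷ u) = cong (a ∷_) (trans (Match-win 1 0 (length u) (λ q _ → refl)) (win-at d u))

dec-true : ∀ {P : Set} (d : Dec P) → does d ≡ true → P
dec-true (yes p) _ = p

true-dec : ∀ {P : Set} (d : Dec P) → P → does d ≡ true
true-dec (yes _) _ = refl
true-dec (no ¬p) p = ⊥-elim (¬p p)

∧-true : ∀ a {b} → a ∧ b ≡ true → a ≡ true × b ≡ true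
∧-true true eq = refl , eq

all-∈ : ∀ {A : Set} (P : A → Bool) {e xs} → all P xs ≡ true → e ∈ xs → P e ≡ true
all-∈ P {xs = a ∷ _} eq (here refl) = proj₁ (∧-true (P a) eq)
all-∈ P {xs = a ∷ _} eq (there e∈) = all-∈ P (proj₂ (∧-true (P a) eq)) e∈

any-∈ : ∀ {A : Set} (P : A → Bool) {e xs} → e ∈ xs → P e ≡ true → any P xs ≡ true
any-∈ P {xs = a ∷ _} (here refl) eq rewrite eq = refl
any-∈ P {xs = a ∷ xs} (there e∈) eq with P a
... | true = refl
... | false = any-∈ P e∈ eq

module Decidable {B : Set} (_≟B_ : DecidableEquality B) where

  _==_ : List B → List B → Bool
  [] == [] = true
  (a ∷ u) == (b ∷ v) = if does (a ≟B b) then u == v else false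
  _ == _ = false

  ==-refl : ∀ u → (u == u) ≡ true
  ==-refl [] = refl
  ==-refl (a ∷ u) rewrite true-dec (a ≟B a) refl = ==-refl u

  prefix : List B → List B → Bool
  prefix [] v = true
  prefix (a ∷ u) [] = false
  prefix (a ∷ u) (b ∷ v) = if does (a ≟B b) then prefix u v else false

  prefix-++ : ∀ u v → prefix u (u ++ v) ≡ true
  prefix-++ [] v = refl
  prefix-++ (a ∷ u) v rewrite true-dec (a ≟B a) refl = prefix-++ u v

  lcp : List B → List B → ℕ
  lcp (a ∷ u) (b ∷ v) = if does (a ≟B b) then suc (lcp u v) else 0
  lcp _ _ = 0

  Match-lcp : ∀ {s : ℕ → B} i j n {N N′} → n ≤ N → n ≤ N′ → Match s i j n → n ≤ lcp (win s i N) (win s j N′)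
  Match-lcp i j zero _ _ match = z≤n
  Match-lcp {s} i j (suc n) (s≤s n≤N) (s≤s n≤N′) match
    rewrite true-dec (s i ≟B s j) (trans (cong s (sym (+-identityʳ i))) (trans (match 0 z<s) (cong s (+-identityʳ j)))) =
    s≤s (Match-lcp (suc i) (suc j) n n≤N n≤N′ λ q q<n → trans (cong s (sym (+-suc i q))) (trans (match (suc q) (s<s q<n)) (cong s (+-suc j q))))

  -- Meant for `v` equal to `u` without its first `p` letters. One common prefix length `c` treats
  -- all repetitions of a given period at once: the words that start `u` and recur after that period
  -- are its prefixes of length at most `c`, so `f` only has to range over these lengths.
  allPeriods : ℕ → ℕ → List B → List B → (ℕ → ℕ → Bool) → Bool
  allPeriods zero p u v f = true
  allPeriods (suc l) p u v f = f (suc p) (lcp u (drop 1 v)) ∧ allPeriods l (suc p) u (drop 1 v) f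

  -- The recursion keeps the second word equal to the window shifted by `p₀`. A match that lies
  -- inside the window forces the common prefix to be at least as long, whence n ≤ c.
  allPeriods-sound : ∀ (s : ℕ → B) i n N f → ∀ l p₀ → allPeriods l p₀ (win s i N) (drop p₀ (win s i N)) f ≡ true →
    ∀ d → d < l → n + (suc d + p₀) ≤ N → Match s i (i + (suc d + p₀)) n → ∃ λ c → n ≤ c × f (suc d + p₀) c ≡ true
  allPeriods-sound s i n N f (suc l) p₀ eq zero _ le match =
    _ , subst (λ □ → n ≤ lcp (win s i N) □) (sym (trans (drop-drop p₀ 1 _) (trans (cong (λ □ → drop □ (win s i N)) (+-comm p₀ 1)) (drop-win s i (suc p₀) N))))
          (Match-lcp i (i + suc p₀) n (≤-trans (m≤m+n n _) le) (m+n≤o⇒m≤o∸n n le) match) ,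
    proj₁ (∧-true (f (suc p₀) _) eq)
  allPeriods-sound s i n N f (suc l) p₀ eq (suc d) (s≤s d<l) le match
    rewrite sym (+-suc d p₀) =
    allPeriods-sound s i n N f l (suc p₀)
      (subst (λ □ → allPeriods l (suc p₀) (win s i N) □ f ≡ true) (trans (drop-drop p₀ 1 _) (cong (λ □ → drop □ (win s i N)) (+-comm p₀ 1))) (proj₂ (∧-true (f (suc p₀) _) eq)))
      d d<l le match

allUpTo : ℕ → (ℕ → Bool) → Bool
allUpTo zero f = true
allUpTo (suc n) f = f (suc n) ∧ allUpTo n f

allUpTo-sound : ∀ c f → allUpTo c f ≡ true → ∀ n → 0 < n → n ≤ c → f n ≡ true
allUpTo-sound zero f eq (suc n) _ ()
allUpTo-sound (suc c) f eq n 0<n n≤1+c with m≤n⇒m<n∨m≡n n≤1+c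
... | inj₂ refl = proj₁ (∧-true (f n) eq)
... | inj₁ (s≤s n≤c) = allUpTo-sound c f (proj₂ (∧-true (f (suc c)) eq)) n 0<n n≤c

-- Exhaustive checks over the windows of a uniform image

module Image {A B : Set} (L : ℕ) .{{_ : NonZero L}} (code : A → List B) (length-code : ∀ a → length (code a) ≡ L)
  (default : B) (t : ℕ → A) (w : ℕ → B) (w-at : ∀ i → w i ≡ at default (code (t (i / L))) (i % L))
  where

  w-block : ∀ c r → r < L → w (c * L + r) ≡ at default (code (t c)) r
  w-block c r r<L = trans (w-at (c * L + r)) (cong₂ (λ c r → at default (code (t c)) r) quotient remainder)
    where
    quotient : (c * L + r) / L ≡ c
    quotient = trans (+-distrib-/-∣ˡ r (divides c refl)) (trans (cong₂ _+_ (m*n/n≡m c L) (m<n⇒m/n≡0 r<L)) (+-identityʳ c))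
    remainder : (c * L + r) % L ≡ r
    remainder = trans (cong (_% L) (+-comm (c * L) r)) (trans ([m+kn]%n≡m%n r c L) (m<n⇒m%n≡m r<L))

  win-block : ∀ c → win w (c * L) L ≡ code (t c)
  win-block c = trans (Match-win (c * L) 0 L λ q q<L → w-block c q q<L)
    (trans (cong (win (at default (code (t c))) 0) (sym (length-code (t c)))) (win-at default (code (t c))))

  win-blocks : ∀ c l → win w (c * L) (l * L) ≡ concatMap code (win t c l)
  win-blocks c zero = refl
  win-blocks c (suc l) = trans (win-++ w (c * L) L (l * L)) (cong₂ _++_ (win-block c)
    (trans (cong (λ □ → win w □ (l * L)) (+-comm (c * L) L)) (win-blocks (suc c) l)))

  offsets : ℕ → ℕ → ℕ → List B → List (ℕ × List B)
  offsets N zero r u = []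
  offsets N (suc l) r u = (r , take N u) ∷ offsets N l (suc r) (drop 1 u)

  ∈-offsets : ∀ N l r u q → q < l → (r + q , take N (drop q u)) ∈ offsets N l r u
  ∈-offsets N (suc l) r u zero _ = here (cong (_, take N u) (+-identityʳ r))
  ∈-offsets N (suc l) r u (suc q) (s≤s q<l) =
    there (subst (_∈ offsets N l (suc r) (drop 1 u)) (cong₂ _,_ (sym (+-suc r q)) (cong (take N) (drop-drop 1 q u))) (∈-offsets N l (suc r) (drop 1 u) q q<l))

  windows : ℕ → List (List A) → List (ℕ × List B)
  windows N F = concatMap (λ u → offsets N L 0 (concatMap code u)) F

  -- A window starts at offset at most L - 1 of its first block, so L - 1 + N ≤ l * L keeps it
  -- inside the image of l letters. A list of all factors of `t` of length l thus accounts for every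
  -- window of `w` of length N.
  ∈-windows : ∀ {N F} l i → L + N ≤ suc (l * L) → win t (i / L) l ∈ F → (i % L , win w i N) ∈ windows N F
  ∈-windows {N} {F} l i fits ∈F = subst (_∈ windows N F) (cong (i % L ,_) eq)
      (∈-concatMap⁺ (λ u → offsets N L 0 (concatMap code u)) (lose ∈F (∈-offsets N L 0 (concatMap code (win t c l)) r (m%n<n i L))))
    where
    c = i / L
    r = i % L
    eq : take N (drop r (concatMap code (win t c l))) ≡ win w i N
    eq = trans (cong (take N ∘ drop r) (sym (win-blocks c l))) (trans (take-drop-win w (c * L) r N (l * L) r+N≤)
           (cong (λ □ → win w □ N) (trans (+-comm (c * L) r) (sym (m≡m%n+[m/n]*n i L)))))
      where
      r+N≤ : r + N ≤ l * L
      r+N≤ = s≤s⁻¹ (≤-trans (+-monoˡ-≤ N (m%n<n i L)) fits)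

  all-windows : ∀ N F l (P : ℕ × List B → Bool) → L + N ≤ suc (l * L) → all P (windows N F) ≡ true →
                ∀ i → win t (i / L) l ∈ F → P (i % L , win w i N) ≡ true
  all-windows N F l P fits check i ∈F = all-∈ P check (∈-windows l i fits ∈F)

  module Checks (_≟A_ : DecidableEquality A) (_≟B_ : DecidableEquality B) where
    open Decidable _≟B_

    locate : List (ℕ × List B) → List B → ℕ
    locate [] u = 0
    locate ((r , v) ∷ ws) u = if v == u then r else locate ws u

    -- `locate` depends on the word alone. If it returns the recorded offset for every listed
    -- window, equal windows have equal offsets.
    syncCheck : List (ℕ × List B) → Bool
    syncCheck ws = all (λ (r , u) → locate ws u ≡ᵇ r) ws

    sync : ∀ {F M} l → L + M ≤ suc (l * L) → (∀ c → win t c l ∈ F) → syncCheck (windows M F) ≡ true →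
           ∀ i j → Match w i j M → i % L ≡ j % L
    sync {F} {M} l fits cover check i j match = trans (sym (located i)) (trans (cong (locate (windows M F)) (Match-win i j M match)) (located j))
      where
      located : ∀ i → locate (windows M F) (win w i M) ≡ i % L
      located i = ≡ᵇ⇒≡ _ _ (subst Data.Bool.T (sym (all-windows M F l (λ (r , u) → locate (windows M F) u ≡ᵇ r) fits check i (cover (i / L)))) tt)

    distinct : ℕ → List B → List B → Bool
    distinct s u v = all (λ r → not (take s (drop r u) == take s (drop r v))) (upTo (suc (L ∸ s)))

    separatedCheck : ℕ → List A → Bool
    separatedCheck s letters = all (λ (a , b) → does (a ≟A b) ∨ distinct s (code a) (code b)) (cartesianProduct letters letters)

    separated : ∀ s letters → (∀ a → a ∈ letters) → separatedCheck s letters ≡ true → ∀ a b r → r + s ≤ L →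
                (∀ q → q < s → at default (code a) (r + q) ≡ at default (code b) (r + q)) → a ≡ b
    separated s letters complete check a b r r+s≤L same
      with a ≟A b | all-∈ (λ (a , b) → does (a ≟A b) ∨ distinct s (code a) (code b)) check (∈-cartesianProduct⁺ (complete a) (complete b))
    ... | yes a≡b | _ = a≡b
    ... | no _ | d = ⊥-elim (case trans (sym (all-∈ _ d (∈-upTo⁺ {suc (L ∸ s)} {r} (s≤s (m+n≤o⇒m≤o∸n r r+s≤L))))) (cong not eq) of λ ())
      where
      slice : ∀ a → take s (drop r (code a)) ≡ win (at default (code a)) r s
      slice a = trans (cong (take s ∘ drop r) (sym (win-at default (code a))))
        (take-drop-win (at default (code a)) 0 r s (length (code a)) (subst (r + s ≤_) (sym (length-code a)) r+s≤L))
      eq : (take s (drop r (code a)) == take s (drop r (code b))) ≡ true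
      eq = trans (cong (take s (drop r (code a)) ==_) (trans (slice b) (trans (sym (Match-win r r s same)) (sym (slice a))))) (==-refl (take s (drop r (code a))))

not-<ᵇ : ∀ {m n} → m ≤ n → (n <ᵇ m) ≡ false
not-<ᵇ {m} {n} m≤n with n <ᵇ m in eq
... | false = refl
... | true = ⊥-elim (<⇒≱ (<ᵇ⇒< n m (subst Data.Bool.T (sym eq) tt)) m≤n)

true≢false : true ≢ false
true≢false ()

-- Tries of binary windows

data Trie : Set where
  ∅    : Trie
  leaf : List Bool → Trie
  node : Trie → Trie → Trie

-- Only the common prefix is spelled out in nodes; the two remainders stay whole in leaves.
split : List Bool → List Bool → Trie
split (false ∷ u) (false ∷ v) = node (split u v) ∅
split (true ∷ u) (true ∷ v) = node ∅ (split u v)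
split (false ∷ u) (true ∷ v) = node (leaf u) (leaf v)
split (true ∷ u) (false ∷ v) = node (leaf v) (leaf u)
split [] v = leaf v
split u [] = leaf u

insert : List Bool → Trie → Trie
insert u ∅ = leaf u
insert u (leaf v) = split u v
insert [] (node S T) = node S T
insert (false ∷ u) (node S T) = node (insert u S) T
insert (true ∷ u) (node S T) = node S (insert u T)

-- That the trie holds every window is certified by computation: the checks `oriented` and
-- `avoidingWindow` begin by evaluating `has T u` on the window itself.
trie : List (ℕ × List Bool) → Trie
trie = foldr (λ (_ , u) → insert u) ∅

module DB = Decidable Bool._≟_

has : Trie → List Bool → Bool
has ∅ u = false
has (leaf v) u = DB.prefix u v
has (node S T) [] = true
has (node S T) (false ∷ u) = has S u
has (node S T) (true ∷ u) = has T u

prefix-closed : ∀ u v v′ → DB.prefix (u ++ v) v′ ≡ true → DB.prefix u v′ ≡ true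
prefix-closed [] v v′ eq = refl
prefix-closed (a ∷ u) v (b ∷ v′) eq with does (a Bool.≟ b)
... | true = prefix-closed u v v′ eq

has-closed : ∀ T u v → has T (u ++ v) ≡ true → has T u ≡ true
has-closed (leaf v′) u v eq = prefix-closed u v v′ eq
has-closed (node S T) [] v eq = refl
has-closed (node S T) (false ∷ u) v eq = has-closed S u v eq
has-closed (node S T) (true ∷ u) v eq = has-closed T u v eq

-- Finite checks on reversals and on short occurrences

oriented : Trie → ℕ × List Bool → Bool
oriented T (_ , u) = has T u ∧ not (has T (reverse u))

sg : Bool → List Bool → List Bool
sg false a = a
sg true a = reverse a

-- The admissible signs of y in the other fragment, given that y has signs + and s in this one: in F1, ..., F5 the
-- four signs are never all equal.
signs : Bool → List (Bool × Bool)
signs false = (false , true) ∷ (true , false) ∷ (true , true) ∷ []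
signs true = (false , false) ∷ (false , true) ∷ (true , false) ∷ (true , true) ∷ []

-- Here `b` is the second gap as read in the text. If it is not y with sign `s₂`, there is no first
-- fragment with these signs and nothing to exclude.
absent : Trie → (X Z a b : List Bool) → Bool → Bool
absent T X Z a b s₂ = not (b DB.== sg s₂ a) ∨ all (λ (s₃ , s₄) → not (has T (Z ++ sg s₃ a ++ X ++ sg s₄ a ++ Z))) (signs s₂)

-- The case m = 0 arises from truncated subtraction, when the period is too small for n and k.
-- Lengths with n < m are skipped; exchanging x and z covers them.
avoiding : Trie → List Bool → ℕ → ℕ → ℕ → Bool
avoiding T u n k zero = true
avoiding T u n k m@(suc _) = (n <ᵇ m) ∨ (absent′ false ∧ absent′ true)
  where absent′ = absent T (take n u) (take m (drop (n + k) u)) (take k (drop n u)) (take k (drop (n + k + m) u))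

-- Given the period p, the lengths n and k determine m = p - (n + 2k). As m ≤ n ≤ c and k ≤ K, a
-- period above 2c + 2K can be dismissed at once.
avoidingAt : ℕ → Trie → List Bool → ℕ → ℕ → Bool
avoidingAt K T u p c = (c + c + (K + K) <ᵇ p) ∨ allUpTo c λ n → allUpTo K λ k → avoiding T u n k (p ∸ (n + k + k))

avoidingWindow : ℕ → ℕ → Trie → ℕ × List Bool → Bool
avoidingWindow l K T (_ , u) = has T u ∧ DB.allPeriods l 0 u u (avoidingAt K T u)

-- The trie is passed as an argument so that evaluation shares it between all windows.
Certified : (Trie → ℕ × List Bool → Bool) → List (ℕ × List Bool) → Trie → Set
Certified P ws T = all (P T) ws ≡ true

certify : ∀ P ws T → Certified P ws T → all (P T) ws ≡ true
certify P ws T eq = eq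

length-sg : ∀ s a → length (sg s a) ≡ length a
length-sg false a = refl
length-sg true a = length-reverse a

sg-sg : ∀ s s′ a → sg s a ≡ sg (s xor s′) (sg s′ a)
sg-sg false false a = refl
sg-sg false true a = sym (reverse-involutive a)
sg-sg true false a = refl
sg-sg true true a = refl

-- The first copy of y counts as plain, so the disjunction says that the four signs are not all
-- equal.
signs-complete : ∀ s₂ s₃ s₄ → s₂ ∨ s₃ ∨ s₄ ≡ true → (s₃ , s₄) ∈ signs s₂
signs-complete false false true _ = here refl
signs-complete false true false _ = there (here refl)
signs-complete false true true _ = there (there (here refl))
signs-complete true false false _ = here refl
signs-complete true false true _ = there (here refl)
signs-complete true true false _ = there (there (here refl))
signs-complete true true true _ = there (there (there (here refl)))

-- Exchange the fragments and take the first copy of y in the other fragment as the new y. This xors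
-- all four signs with `s₃`, so they remain not all equal.
swap-signs : ∀ s₂ s₃ s₄ → s₂ ∨ s₃ ∨ s₄ ≡ true → (s₄ xor s₃) ∨ s₃ ∨ (s₂ xor s₃) ≡ true
swap-signs true false false _ = refl
swap-signs true false true _ = refl
swap-signs false false true _ = refl
swap-signs s₂ true true _ = refl
swap-signs s₂ true false _ = refl

nonempty : ∀ {u : List Bool} → u ≢ [] → 0 < length u
nonempty {[]} u≢[] = ⊥-elim (u≢[] refl)
nonempty {_ ∷ _} _ = z<s

-- From occurrences of the formulas to the checks

module Fragments (w : InfWord) (offset : ℕ → ℕ) (K M l N : ℕ) (l-large : M + K + M + K ≤ l) (N-large : M + l ≤ N)
  (oriented-trie : ∃ λ T → ∀ i → oriented T (offset i , win w i (suc K)) ≡ true)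
  (avoiding-trie : ∃ λ T → ∀ i → avoidingWindow l K T (offset i , win w i N) ≡ true)
  (no-long-Occ : ∀ i j n m k → 0 < k → k ≤ K → M < n → Occ w i j n m k k → ⊥)
  where

  occurs-++ : ∀ u {v i} → OccursAt w i (u ++ v) → OccursAt w i u × OccursAt w (i + length u) v
  occurs-++ [] {v} {i} o = tt , subst (λ □ → OccursAt w □ v) (sym (+-identityʳ i)) o
  occurs-++ (a ∷ u) {v} {i} (eq , o) =
    let o₁ , o₂ = occurs-++ u o in (eq , o₁) , subst (λ □ → OccursAt w □ v) (sym (+-suc i (length u))) o₂

  occurs-win : ∀ u {i} → OccursAt w i u → win w i (length u) ≡ u
  occurs-win [] _ = refl
  occurs-win (a ∷ u) (eq , o) = cong₂ _∷_ eq (occurs-win u o)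

  has-window : ∀ T N → (∀ i → has T (win w i N) ≡ true) → ∀ u {i} → length u ≤ N → OccursAt w i u → has T u ≡ true
  has-window T N check u {i} le o = has-closed T u (win w (i + length u) (N ∸ length u)) (trans (cong (has T) (sym eq)) (check i))
    where
    eq : win w i N ≡ u ++ win w (i + length u) (N ∸ length u)
    eq = trans (cong (win w i) (sym (m+[n∸m]≡n le))) (trans (win-++ w i (length u) (N ∸ length u)) (cong (_++ win w (i + length u) (N ∸ length u)) (occurs-win u o)))

  -- Otherwise `a` starts with a factor of length K + 1, and `reverse a` ends with the reversal of
  -- that factor. Both then occur in `w`, against `oriented`.
  reversal-bound : ∀ a {i j} → OccursAt w i a → OccursAt w j (reverse a) → length a ≤ K
  reversal-bound a {i} {j} o oᴿ = ≮⇒≥ λ K< → true≢false (trans (sym (proj₂ (at-window i))) (cong not (has-reverse K<)))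
    where
    T = proj₁ oriented-trie
    at-window : ∀ i → has T (win w i (suc K)) ≡ true × not (has T (reverse (win w i (suc K)))) ≡ true
    at-window i = ∧-true (has T (win w i (suc K))) (proj₂ oriented-trie i)
    v = win w (i + suc K) (length a ∸ suc K)
    a≡ : K < length a → a ≡ win w i (suc K) ++ v
    a≡ K< = trans (sym (occurs-win a o)) (trans (cong (win w i) (sym (m+[n∸m]≡n K<))) (win-++ w i (suc K) (length a ∸ suc K)))
    has-reverse : K < length a → has T (reverse (win w i (suc K))) ≡ true
    has-reverse K< = has-window T (suc K) (λ i → proj₁ (at-window i)) (reverse (win w i (suc K)))
      (≤-reflexive (trans (length-reverse (win w i (suc K))) (length-win w i (suc K))))
      (proj₂ (occurs-++ (reverse v) (subst (OccursAt w j) (trans (cong reverse (a≡ K<)) (reverse-++ (win w i (suc K)) v)) oᴿ)))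

  avoidingWindow-sound : ∀ {T r i} n k m → avoidingWindow l K T (r , win w i N) ≡ true →
    0 < n → 0 < k → 0 < m → m ≤ n → k ≤ K → n + k + m + k ≤ l → n + (n + k + m + k) ≤ N → Match w i (i + (n + k + m + k)) n →
    ∀ s → absent T (win w i n) (win w (i + (n + k)) m) (win w (i + n) k) (win w (i + (n + k + m)) k) s ≡ true
  avoidingWindow-sound {T} {r} {i} n@(suc n₀) k m@(suc _) check 0<n 0<k 0<m m≤n k≤K p≤l le match s =
    trans (sym (cong₂ (λ X Z → absent T X Z (win w (i + n) k) (win w (i + (n + k + m)) k) s)
            (take-win w i (≤-trans (m≤m+n n p) le)) (take-drop-win w i (n + k) m N (≤-trans (m≤m+n (n + k + m) k) p≤N))))
    (trans (sym (cong₂ (λ a b → absent T (take n u) (take m (drop (n + k) u)) a b s)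
            (take-drop-win w i n k N (≤-trans (≤-trans (m≤m+n (n + k) m) (m≤m+n (n + k + m) k)) p≤N)) (take-drop-win w i (n + k + m) k N p≤N)))
    (both s))
    where
    u = win w i N
    p = n + k + m + k
    p≤N : p ≤ N
    p≤N = ≤-trans (m≤n+m p n) le
    found : ∃ λ c → n ≤ c × avoidingAt K T u (p + 0) c ≡ true
    found = DB.allPeriods-sound w i n N (avoidingAt K T u) l 0 (proj₂ (∧-true (has T u) check)) (n₀ + k + m + k) p≤l
      (subst (λ □ → n + □ ≤ N) (sym (+-identityʳ p)) le) (subst (λ □ → Match w i (i + □) n) (sym (+-identityʳ p)) match)
    c = proj₁ found
    n≤c = proj₁ (proj₂ found)
    -- The early exit of `avoidingAt` is not taken, because n and m are at most c and k is at most
    -- K.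
    short : (c + c + (K + K) <ᵇ p) ≡ false
    short = not-<ᵇ (≤-trans (≤-reflexive (lem n k m)) (+-mono-≤ (+-mono-≤ n≤c (≤-trans m≤n n≤c)) (+-mono-≤ k≤K k≤K)))
      where lem : ∀ n k m → n + k + m + k ≡ n + m + (k + k)
            lem = solve-∀
    all-n : allUpTo c (λ n → allUpTo K λ k → avoiding T u n k (p ∸ (n + k + k))) ≡ true
    all-n = subst (λ b → b ∨ allUpTo c (λ n → allUpTo K λ k → avoiding T u n k (p ∸ (n + k + k))) ≡ true) short
      (subst (λ p → avoidingAt K T u p c ≡ true) (+-identityʳ p) (proj₂ (proj₂ found)))
    -- The check computes the length of z from the period; here it is identified with m.
    at-nk : avoiding T u n k m ≡ true
    at-nk = subst (λ m → avoiding T u n k m ≡ true) (trans (cong (_∸ (n + k + k)) (lem n k m)) (m+n∸m≡n (n + k + k) m))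
      (allUpTo-sound K (λ k → avoiding T u n k (p₀ k)) (allUpTo-sound c (λ n → allUpTo K λ k → avoiding T u n k (p ∸ (n + k + k))) all-n n 0<n n≤c) k 0<k k≤K)
      where lem : ∀ n k m → n + k + m + k ≡ n + k + k + m
            lem = solve-∀
            p₀ : ℕ → ℕ
            p₀ k = p ∸ (n + k + k)
    absent′ = absent T (take n u) (take m (drop (n + k) u)) (take k (drop n u)) (take k (drop (n + k + m) u))
    both′ = ∧-true (absent′ false) {absent′ true} (subst (λ b → b ∨ (absent′ false ∧ absent′ true) ≡ true) (not-<ᵇ m≤n) at-nk)
    both : ∀ s → absent′ s ≡ true
    both false = proj₁ both′
    both true = proj₂ both′

  record Frag (i : ℕ) (X a Z b : List Bool) : Set where
    constructor frag
    n = length X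
    k = length a
    m = length Z
    field
      X₁ : OccursAt w i X
      A₁ : OccursAt w (i + n) a
      Z₁ : OccursAt w (i + n + k) Z
      B₁ : OccursAt w (i + n + k + m) b
      X₂ : OccursAt w (i + n + k + m + length b) X
      whole : OccursAt w i (X ++ a ++ Z ++ b ++ X)

  fragment : ∀ i X a Z b → OccursAt w i (X ++ a ++ Z ++ b ++ X ++ []) → Frag i X a Z b
  fragment i X a Z b o =
    -- The trailing `[]` is left over from `concatMap`.
    let o′ = subst (λ □ → OccursAt w i (X ++ a ++ Z ++ b ++ □)) (++-identityʳ X) o
        X₁ , o₁ = occurs-++ X o′
        A₁ , o₂ = occurs-++ a o₁
        Z₁ , o₃ = occurs-++ Z o₂
        B₁ , X₂ = occurs-++ b o₃
    in frag X₁ A₁ Z₁ B₁ X₂ o′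

  Match-occurs : ∀ u {i j} → OccursAt w i u → OccursAt w j u → Match w i j (length u)
  Match-occurs u {i} {j} o o′ = win-Match i j (length u) (trans (occurs-win u o) (sym (occurs-win u o′)))

  -- The first fragment makes X recur at period n + k + m + k in the window at i, so the check of
  -- that window excludes the word V of the second fragment from the trie. But V occurs at j and has
  -- length at most N, so the trie contains it.
  small : ∀ X Z a s₂ s₃ s₄ i j → s₂ ∨ s₃ ∨ s₄ ≡ true → Frag i X a Z (sg s₂ a) → Frag j Z (sg s₃ a) X (sg s₄ a) →
    0 < length X → 0 < length Z → 0 < length a → length Z ≤ length X → length X ≤ M → length a ≤ K → ⊥
  small X Z a s₂ s₃ s₄ i j mixed F G 0<n 0<m 0<k m≤n n≤M k≤K =
      true≢false (trans (sym not-has) (cong not (has-window T N has-all V length-V (Frag.whole G))))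
    where
    n = length X
    m = length Z
    k = length a
    T = proj₁ avoiding-trie
    b = sg s₂ a
    V = Z ++ sg s₃ a ++ X ++ sg s₄ a ++ Z
    checked : ∀ i → avoidingWindow l K T (offset i , win w i N) ≡ true
    checked = proj₂ avoiding-trie
    has-all : ∀ i → has T (win w i N) ≡ true
    has-all i = proj₁ (∧-true (has T (win w i N)) (checked i))
    m≤M = ≤-trans m≤n n≤M
    p≤l : n + k + m + k ≤ l
    p≤l = ≤-trans (+-mono-≤ (+-mono-≤ (+-mono-≤ n≤M k≤K) m≤M) k≤K) l-large
    length-V : length V ≤ N
    length-V = ≤-trans (≤-reflexive length-V≡) (≤-trans (≤-reflexive (lem m k n)) (≤-trans (+-mono-≤ m≤M p≤l) N-large))
      where
      lem : ∀ m k n → m + (k + (n + (k + m))) ≡ m + (n + k + m + k)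
      lem = solve-∀
      length-V≡ : length V ≡ m + (k + (n + (k + m)))
      length-V≡ = trans (length-++ Z) (cong (m +_) (trans (length-++ (sg s₃ a)) (cong₂ _+_ (length-sg s₃ a)
        (trans (length-++ X) (cong (n +_) (trans (length-++ (sg s₄ a)) (cong (_+ m) (length-sg s₄ a))))))))
    period : i + n + k + m + length b ≡ i + (n + k + m + k)
    period = trans (cong (i + n + k + m +_) (length-sg s₂ a)) (lem i n k m)
      where lem : ∀ i n k m → i + n + k + m + k ≡ i + (n + k + m + k)
            lem = solve-∀
    absent-at : absent T (win w i n) (win w (i + (n + k)) m) (win w (i + n) k) (win w (i + (n + k + m)) k) s₂ ≡ true
    absent-at = avoidingWindow-sound {T} {offset i} {i} n k m (checked i) 0<n 0<k 0<m m≤n k≤K p≤l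
      (≤-trans (+-mono-≤ n≤M p≤l) N-large)
      (subst (λ □ → Match w i □ n) period (Match-occurs X (Frag.X₁ F) (Frag.X₂ F))) s₂
    b-win : win w (i + (n + k + m)) k ≡ b
    b-win = trans (cong₂ (win w) (lem i n k m) (sym (length-sg s₂ a))) (occurs-win b (Frag.B₁ F))
      where lem : ∀ i n k m → i + (n + k + m) ≡ i + n + k + m
            lem = solve-∀
    absent-XZ : absent T X Z a b s₂ ≡ true
    absent-XZ = trans (sym (trans (cong₂ (λ X Z → absent T X Z (win w (i + n) k) (win w (i + (n + k + m)) k) s₂)
        (occurs-win X (Frag.X₁ F)) (trans (cong (λ □ → win w □ m) (sym (+-assoc i n k))) (occurs-win Z (Frag.Z₁ F))))
      (cong₂ (λ a b → absent T X Z a b s₂) (occurs-win a (Frag.A₁ F)) b-win))) absent-at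
    not-has : not (has T V) ≡ true
    not-has = all-∈ (λ (s₃ , s₄) → not (has T (Z ++ sg s₃ a ++ X ++ sg s₄ a ++ Z)))
      (subst (λ □ → not □ ∨ all (λ (s₃ , s₄) → not (has T (Z ++ sg s₃ a ++ X ++ sg s₄ a ++ Z))) (signs s₂) ≡ true) (DB.==-refl b) absent-XZ)
      (signs-complete s₂ s₃ s₄ mixed)

  reversed-occurs : ∀ {X Z a s₂ s₃ s₄ i j} → s₂ ∨ s₃ ∨ s₄ ≡ true → Frag i X a Z (sg s₂ a) → Frag j Z (sg s₃ a) X (sg s₄ a) →
    ∃ λ l → OccursAt w l (reverse a)
  reversed-occurs {s₂ = true} _ F G = _ , Frag.B₁ F
  reversed-occurs {s₂ = false} {true} _ F G = _ , Frag.A₁ G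
  reversed-occurs {s₂ = false} {false} {true} _ F G = _ , Frag.B₁ G

  no-fragments : ∀ X Z a s₂ s₃ s₄ i j → s₂ ∨ s₃ ∨ s₄ ≡ true → X ≢ [] → Z ≢ [] → a ≢ [] →
    OccursAt w i (X ++ a ++ Z ++ sg s₂ a ++ X ++ []) → OccursAt w j (Z ++ sg s₃ a ++ X ++ sg s₄ a ++ Z ++ []) → ⊥
  no-fragments X Z a s₂ s₃ s₄ i j mixed X≢[] Z≢[] a≢[] o₁ o₂ = case M <? n of λ where
      (yes M<n) → no-long-Occ i j n m k 0<k k≤K M<n o
      (no M≮n) → case M <? m of λ where
        (yes M<m) → no-long-Occ j i m n k 0<k k≤K M<m (swapOcc o)
        (no M≮m) → case ≤-total m n of λ where
          (inj₁ m≤n) → small X Z a s₂ s₃ s₄ i j mixed F G 0<n 0<m 0<k m≤n (≮⇒≥ M≮n) k≤K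
          -- The longer of x and z takes the role of x; the new y is `sg s₃ a`, so that the first
          -- sign is again plain.
          (inj₂ n≤m) → small Z X (sg s₃ a) (s₄ xor s₃) s₃ (s₂ xor s₃) j i (swap-signs s₂ s₃ s₄ mixed)
            (subst (Frag j Z (sg s₃ a) X) (sg-sg s₄ s₃ a) G)
            (subst₂ (λ b c → Frag i X b Z c) (sg-sg false s₃ a) (sg-sg s₂ s₃ a) F)
            0<m 0<n (subst (0 <_) (sym (length-sg s₃ a)) 0<k) n≤m (≮⇒≥ M≮m) (subst (_≤ K) (sym (length-sg s₃ a)) k≤K)
    where
    n = length X
    m = length Z
    k = length a
    F = fragment i X a Z (sg s₂ a) o₁
    G = fragment j Z (sg s₃ a) X (sg s₄ a) o₂
    0<n = nonempty X≢[]
    0<m = nonempty Z≢[]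
    0<k = nonempty a≢[]
    k≤K : k ≤ K
    k≤K = reversal-bound a (Frag.A₁ F) (proj₂ (reversed-occurs {X} {Z} {a} {s₂} {s₃} {s₄} {i} {j} mixed F G))
    along : ∀ {u p q q′} → q ≡ q′ → OccursAt w p u → OccursAt w q u → Match w p q′ (length u)
    along {u} refl = Match-occurs u
    position : ∀ i n m s → i + n + k + m + length (sg s a) ≡ i + (n + k + m + k)
    position i n m s = trans (cong (i + n + k + m +_) (length-sg s a)) (lem i n k m)
      where lem : ∀ i n k m → i + n + k + m + k ≡ i + (n + k + m + k)
            lem = solve-∀
    after : ∀ {v} → j + m + length (sg s₃ a) ≡ v → j + m + k ≡ v
    after eq = trans (cong (j + m +_) (sym (length-sg s₃ a))) eq
    o : Occ w i j n m k k
    o = occ (along (position i n m s₂) (Frag.X₁ F) (Frag.X₂ F))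
            (along (sym (after refl)) (Frag.X₁ F) (Frag.Z₁ G))
            (along (trans (cong (λ □ → j + m + □ + n + length (sg s₄ a)) (length-sg s₃ a)) (position j m n s₄)) (Frag.X₁ G) (Frag.X₂ G))
            (along refl (Frag.X₁ G) (Frag.Z₁ F))

-- The five-letter word t

Letter : Set
Letter = Fin 5

next : Letter → Letter
next 0F = 1F
next 1F = 2F
next 2F = 3F
next 3F = 4F
next 4F = 0F

rotate : ℕ → Letter → Letter
rotate zero a = a
rotate (suc n) a = next (rotate n a)

seed : List Letter
seed = 0F ∷ 1F ∷ 2F ∷ 0F ∷ 3F ∷ 1F ∷ 2F ∷ 3F ∷ 1F ∷ 4F ∷ 2F ∷ 0F ∷ []

-- Defined to commute with the cyclic rotation of the alphabet, so lists of factors can be given by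
-- representatives starting with 0.
f : Letter → List Letter
f a = map (rotate (toℕ a)) seed

rotations : List (List Letter) → List (List Letter)
rotations us = concatMap (λ a → map (map (rotate (toℕ a))) us) (allFin 5)

pairs triples quadruples : List (List Letter)
pairs = rotations ((0F ∷ 1F ∷ []) ∷ (0F ∷ 3F ∷ []) ∷ [])
triples = rotations ((0F ∷ 1F ∷ 2F ∷ []) ∷ (0F ∷ 1F ∷ 4F ∷ []) ∷ (0F ∷ 3F ∷ 1F ∷ []) ∷ (0F ∷ 3F ∷ 4F ∷ []) ∷ [])
quadruples = rotations ((0F ∷ 1F ∷ 2F ∷ 0F ∷ []) ∷ (0F ∷ 1F ∷ 2F ∷ 3F ∷ []) ∷ (0F ∷ 1F ∷ 4F ∷ 2F ∷ [])
  ∷ (0F ∷ 3F ∷ 1F ∷ 2F ∷ []) ∷ (0F ∷ 3F ∷ 1F ∷ 4F ∷ []) ∷ (0F ∷ 3F ∷ 4F ∷ 0F ∷ []) ∷ [])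

-- approx k is correct on [0, k].
approx : ℕ → ℕ → Letter
approx zero n = 0F
approx (suc k) n = at 0F (f (approx k (n / 12))) (n % 12)

t : ℕ → Letter
t n = approx n n

n/12≤k : ∀ {n k} → n ≤ suc k → n / 12 ≤ k
n/12≤k {zero} _ = z≤n
n/12≤k {suc n} {k} n≤1+k = s≤s⁻¹ (<-≤-trans (m/n<m (suc n) 12 (s≤s (s≤s z≤n))) n≤1+k)

approx-stable : ∀ k k′ n → n ≤ k → n ≤ k′ → approx k n ≡ approx k′ n
approx-stable zero zero n _ _ = refl
approx-stable zero (suc k′) zero _ _ = cong (λ a → at 0F (f a) 0) (approx-stable zero k′ zero z≤n z≤n)
approx-stable (suc k) zero zero _ _ = cong (λ a → at 0F (f a) 0) (approx-stable k zero zero z≤n z≤n)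
approx-stable (suc k) (suc k′) n n≤k n≤k′ = cong (λ a → at 0F (f a) (n % 12)) (approx-stable k k′ (n / 12) (n/12≤k n≤k) (n/12≤k n≤k′))

t-at : ∀ n → t n ≡ at 0F (f (t (n / 12))) (n % 12)
t-at zero = refl
t-at n@(suc k) = cong (λ a → at 0F (f a) (n % 12)) (approx-stable k (n / 12) (n / 12) (n/12≤k ≤-refl) ≤-refl)

length-f : ∀ a → length (f a) ≡ 12
length-f a = length-map (rotate (toℕ a)) seed

module Base = Image 12 f length-f 0F t t t-at
module BaseChecks = Base.Checks Fin._≟_ Fin._≟_

open DecMembership (≡-dec (Fin._≟_ {5})) using (_∈?_)

cover-step : ∀ N F → all (λ (_ , u) → does (u ∈? F)) (Base.windows N pairs) ≡ true → 12 + N ≤ 25 →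
             ∀ i → win t (i / 12) 2 ∈ pairs → win t i N ∈ F
cover-step N F check fits i ∈pairs = dec-true (win t i N ∈? F) (Base.all-windows N pairs 2 (λ (_ , u) → does (u ∈? F)) fits check i ∈pairs)

-- Induction on the position: the pair at i lies in the image of the pair at i / 12, and evaluation
-- shows that images of listed pairs contain only listed pairs.
pairs-cover : ∀ i → win t i 2 ∈ pairs
pairs-cover = <-rec _ λ where
  zero _ → here refl
  i@(suc _) rec → cover-step 2 pairs refl (≤ᵇ⇒≤ 14 25 tt) i (rec (m/n<m i 12 (s≤s (s≤s z≤n))))

triples-cover : ∀ i → win t i 3 ∈ triples
triples-cover i = cover-step 3 triples refl (≤ᵇ⇒≤ 15 25 tt) i (pairs-cover (i / 12))

quadruples-cover : ∀ i → win t i 4 ∈ quadruples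
quadruples-cover i = cover-step 4 quadruples refl (≤ᵇ⇒≤ 16 25 tt) i (pairs-cover (i / 12))

-- Images of different letters are different rotations of `seed` and so differ at every position,
-- whence s = 1. Ten consecutive letters determine the position modulo 12.
module M₁ = Morphism 12 (λ a → at 0F (f a)) t t Base.w-block 1 10 (≤ᵇ⇒≤ 1 12 tt) (≤ᵇ⇒≤ 1 1 tt)
  (BaseChecks.separated 1 (allFin 5) ∈-allFin refl)
  (BaseChecks.sync {pairs} {10} 2 (≤ᵇ⇒≤ 22 25 tt) pairs-cover refl)

module DL = Decidable (Fin._≟_ {5})

factorOf : List (ℕ × List Letter) → List Letter → Bool
factorOf ws v = any (λ (_ , u) → DL.prefix v u) ws

-- With XZX at the start of `u`, the word sought is ZXZ. For m = 0 it is X, which is a factor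
-- whenever `u` is a listed window; so the check also excludes squares XX.
noFactor : List (ℕ × List Letter) → List Letter → ℕ → ℕ → Bool
noFactor ws u n m = (n <ᵇ m) ∨ not (factorOf ws (take m (drop n u) ++ take n u ++ take m (drop n u)))

repetitionFree : ℕ → List (ℕ × List Letter) → ℕ × List Letter → Bool
repetitionFree l ws (_ , u) = DL.allPeriods l 0 u u λ p c → allUpTo c λ n → noFactor ws u n (p ∸ n)

repetitionFree-sound : ∀ {l N ws r i} n m → repetitionFree l ws (r , win t i N) ≡ true → 0 < n → n + m ≤ l → n + (n + m) ≤ N →
                       Match t i (i + (n + m)) n → noFactor ws (win t i N) n m ≡ true
repetitionFree-sound {l} {N} {ws} {r} {i} n@(suc n₀) m check 0<n n+m≤l le match =
  let c , n≤c , passed = DL.allPeriods-sound t i n N (λ p c → allUpTo c λ n → noFactor ws (win t i N) n (p ∸ n)) l 0 check (n₀ + m) n+m≤l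
                           (subst (λ □ → n + □ ≤ N) (sym (+-identityʳ (n + m))) le) (subst (λ □ → Match t i (i + □) n) (sym (+-identityʳ (n + m))) match)
  in subst (λ □ → noFactor ws (win t i N) n □ ≡ true) (trans (cong (_∸ n) (+-identityʳ (n + m))) (m+n∸m≡n n m))
       (allUpTo-sound c (λ n → noFactor ws (win t i N) n (suc (n₀ + m) + 0 ∸ n)) passed n 0<n n≤c)

repetitionFree-all : List (ℕ × List Letter) → Bool
repetitionFree-all ws = all (repetitionFree 18 ws) ws

abstract
  -- Lengths of X and Z up to 9 give periods up to 18 and words XZX, ZXZ of length up to 27.
  repetitionFree-check : repetitionFree-all (Base.windows 27 quadruples) ≡ true
  repetitionFree-check = refl

prefix-factorOf : ∀ j k → k ≤ 27 → factorOf (Base.windows 27 quadruples) (win t j k) ≡ true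
prefix-factorOf j k k≤27 = any-∈ (λ (_ , u) → DL.prefix (win t j k) u)
  (Base.∈-windows {27} {quadruples} 4 j (≤ᵇ⇒≤ 39 49 tt) (quadruples-cover (j / 12)))
  (subst (λ u → DL.prefix (win t j k) u ≡ true) (sym (trans (cong (win t j) (sym (m+[n∸m]≡n k≤27))) (win-++ t j k (27 ∸ k))))
    (DL.prefix-++ (win t j k) _))

-- By `xx₁` the window at i starts with XZX. The other matches identify ZXZ, spelled with the
-- letters read at i, with the factor at j, which the check forbids.
no-small-Occ : ∀ i j n m → m ≤ n → 0 < n → n ≤ 9 → Occ t i j n m 0 0 → ⊥
no-small-Occ i j n m m≤n 0<n n≤9 (occ xx₁ xx₂ zz₁ zz₂) =
    true≢false (trans (sym not-factor) (cong not (trans (cong (factorOf ws) word) (prefix-factorOf j (m + (n + m)) m+n+m≤27))))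
  where
  ws = Base.windows 27 quadruples
  u = win t i 27
  p = n + m
  n+m≤18 : p ≤ 18
  n+m≤18 = +-mono-≤ n≤9 (≤-trans m≤n n≤9)
  n+p≤27 : n + p ≤ 27
  n+p≤27 = +-mono-≤ n≤9 n+m≤18
  m+n+m≤27 : m + (n + m) ≤ 27
  m+n+m≤27 = ≤-trans (+-monoˡ-≤ p m≤n) n+p≤27
  passed : noFactor ws u n m ≡ true
  passed = repetitionFree-sound {18} {27} {ws} {i % 12} {i} n m
    (Base.all-windows 27 quadruples 4 (repetitionFree 18 ws) (≤ᵇ⇒≤ 39 49 tt) repetitionFree-check i (quadruples-cover (i / 12)))
    0<n n+m≤18 n+p≤27 (subst (λ □ → Match t i (i + □) n) (trans (+-identityʳ _) (cong (_+ m) (+-identityʳ n))) xx₁)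
  Z = take m (drop n u)
  not-factor : not (factorOf ws (Z ++ take n u ++ Z)) ≡ true
  not-factor = subst (λ b → b ∨ not (factorOf ws (Z ++ take n u ++ Z)) ≡ true) (not-<ᵇ m≤n)
    passed
  Z≡ : Z ≡ win t j m
  Z≡ = trans (take-drop-win t i n m 27 (≤-trans n+m≤18 (≤ᵇ⇒≤ 18 27 tt)))
       (trans (cong (λ □ → win t □ m) (sym (+-identityʳ (i + n)))) (sym (Match-win j (i + n + 0) m zz₂)))
  word : Z ++ take n u ++ Z ≡ win t j (m + (n + m))
  word = trans (cong₂ (λ Z X → Z ++ X ++ Z) Z≡
      (trans (take-win t i (≤-trans n≤9 (≤ᵇ⇒≤ 9 27 tt))) (trans (Match-win i (j + m + 0) n xx₂) (cong (λ □ → win t □ n) (+-identityʳ (j + m))))))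
    (trans (cong (λ □ → win t j m ++ win t (j + m) n ++ □) (trans (Match-win j _ m zz₁) (cong (λ □ → win t □ m) (lem j m n))))
      (sym (trans (win-++ t j m (n + m)) (cong (win t j m ++_) (win-++ t (j + m) n m)))))
    where lem : ∀ j m n → j + (m + 0 + n + 0) ≡ j + m + n
          lem = solve-∀

shrinks : ∀ {q p} → q * 12 ≡ p → 0 < p → q < p × 0 < q
shrinks {zero} refl ()
shrinks {suc q} refl _ = m<m*n (suc q) 12 (s≤s (s≤s z≤n)) , z<s

-- Infinite descent on the period: `descend` divides it by 12, so it stays positive and strictly
-- decreases.
no-Occ : ∀ p i j n m → n + m ≡ p → 0 < p → Occ t i j n m 0 0 → ⊥
no-Occ = <-rec _ λ p rec →
  let
    large : ∀ i j n m → n + m ≡ p → 0 < p → 10 ≤ n → Occ t i j n m 0 0 → ⊥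
    large i j n m n+m 0<p 10≤n o =
      let i′ , j′ , n′ , m′ , eq , o′ = M₁.descend i j n m 0 0 (≤ᵇ⇒≤ 2 13 tt) (≤ᵇ⇒≤ 2 13 tt) (≤ᵇ⇒≤ 1 10 tt) 10≤n (long m) o
          q<p , 0<q = shrinks (trans eq (trans (+-identityʳ _) (trans (cong (_+ m) (+-identityʳ n)) n+m))) 0<p
      in rec q<p i′ j′ n′ m′ refl 0<q o′
  in λ i j n m n+m 0<p o → case 10 ≤? n of λ where
    (yes 10≤n) → large i j n m n+m 0<p 10≤n o
    (no n≱10) → case 10 ≤? m of λ where
      (yes 10≤m) → large j i m n (trans (+-comm m n) n+m) 0<p 10≤m (swapOcc o)
      (no m≱10) → case ≤-total m n of λ where
        (inj₁ m≤n) → no-small-Occ i j n m m≤n (positive m≤n (subst (0 <_) (sym n+m) 0<p)) (s≤s⁻¹ (≰⇒> n≱10)) o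
        (inj₂ n≤m) → no-small-Occ j i m n n≤m (positive n≤m (subst (0 <_) (sym (trans (+-comm m n) n+m)) 0<p)) (s≤s⁻¹ (≰⇒> m≱10)) (swapOcc o)
  where
  -- As s = 1, every nonempty word is long enough, and all gaps are empty here.
  long : ∀ m → M₁.Long m 0
  long zero = inj₂ (refl , refl)
  long (suc m) = inj₁ (s≤s z≤n)
  positive : ∀ {m n} → m ≤ n → 0 < n + m → 0 < n
  positive {n = zero} z≤n ()
  positive {n = suc n} _ _ = z<s

-- The binary word w

bits : ℕ → ℕ → List Bool → List Bool
bits zero c u = u
bits (suc l) c u = bits l (c / 2) ((c % 2 ≡ᵇ 1) ∷ u)

length-bits : ∀ l c u → length (bits l c u) ≡ l + length u
length-bits zero c u = refl
length-bits (suc l) c u = trans (length-bits l (c / 2) _) (+-suc l (length u))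

-- Found by computer search.
numeral : Letter → ℕ
numeral 0F = 0b0110000100111101001011001111011000011110100101100110000100111101100001001011001111000010011110100101100111101100001011001100001111010010110
numeral 1F = 0b0110000100111101100001001011001111000010011110110000111101001011001100001001011001111000010011110100101100111101100001001011001111000010110
numeral 2F = 0b0110000100111101100001011001100001111010010110011110000100111101001011001111011000010010110011110000100111101100001011001100001111010010110
numeral 3F = 0b0110000100111101001011001111011000010010110011110000100111101100001111010010110011000010011110110000101100110000111101001011001111000010110
numeral 4F = 0b0110000100111101001011001111011000010110011000011110100101100111100001001111010010110011110110000111101001011001100001001011001111000010110

-- Most significant digit first; the fixed length 139 restores the leading zero of each numeral.
g : Letter → List Bool
g a = bits 139 (numeral a) []

w : InfWord
w i = at false (g (t (i / 139))) (i % 139)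

module Binary = Image 139 g (λ a → length-bits 139 (numeral a) []) false t w (λ _ → refl)
module BinaryChecks = Binary.Checks Fin._≟_ Bool._≟_

abstract
  w-separated : ∀ a b r → r + 40 ≤ 139 → (∀ q → q < 40 → at false (g a) (r + q) ≡ at false (g b) (r + q)) → a ≡ b
  w-separated = BinaryChecks.separated 40 (allFin 5) ∈-allFin refl

  w-sync : ∀ i j → Match w i j 78 → i % 139 ≡ j % 139
  w-sync = BinaryChecks.sync {pairs} {78} 2 (≤ᵇ⇒≤ 217 279 tt) pairs-cover refl

module M₂ = Morphism 139 (λ a → at false (g a)) t w Binary.w-block 40 78 (≤ᵇ⇒≤ 40 139 tt) (≤ᵇ⇒≤ 1 40 tt) w-separated w-sync

positive-factor : ∀ {q l p} → q * l ≡ p → 0 < p → 0 < q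
positive-factor {zero} refl ()
positive-factor {suc q} _ _ = z<s

no-long-pair : ∀ i j n m k → 0 < k → k ≤ 10 → 78 ≤ n → 40 ≤ m → Occ w i j n m k k → ⊥
no-long-pair i j n m k 0<k k≤10 78≤n 40≤m o =
  let gap = ≤-trans (+-monoʳ-≤ 80 k≤10) (≤ᵇ⇒≤ 90 140 tt)
      i′ , j′ , n′ , m′ , eq , o′ = M₂.descend i j n m k k gap gap (≤ᵇ⇒≤ 40 78 tt) 78≤n (inj₁ 40≤m) o
  in no-Occ (n′ + m′) i′ j′ n′ m′ refl (positive-factor eq (≤-trans 0<k (m≤n+m k (n + k + m)))) o′

-- This is an occurrence with empty z placed right after the first x, so that the gap before z is
-- empty and `κ` is the gap after it. The bound is 59 = 10 + 39 + 10, for a z of at most 39 letters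
-- between two copies of y, and 2 * 40 + 59 ≤ 140 is the gap condition of `descend`.
no-long-square : ∀ i n κ → 0 < κ → κ ≤ 59 → 78 ≤ n → Match w i (i + n + 0 + κ) n → ⊥
no-long-square i n κ 0<κ κ≤59 78≤n match =
  let i′ , j′ , n′ , m′ , eq , o′ = M₂.descend i (i + n) n 0 0 κ (≤ᵇ⇒≤ 80 140 tt) (≤-trans (+-monoʳ-≤ 80 κ≤59) (≤ᵇ⇒≤ 139 140 tt))
        (≤ᵇ⇒≤ 40 78 tt) 78≤n (inj₂ (refl , refl)) (occ (subst (λ □ → Match w i □ n) (shift-assoc i n κ) match) match (λ _ ()) (λ _ ()))
  in no-Occ (n′ + m′) i′ j′ n′ m′ refl (positive-factor eq (≤-trans 0<κ (m≤n+m κ (n + 0 + 0)))) o′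
  where
  shift-assoc : ∀ i n κ → i + n + 0 + κ ≡ i + (n + 0 + 0 + κ)
  shift-assoc = solve-∀

-- If z is too short to determine a block, it is absorbed, with the two copies of y, into a single gap.
no-long-Occ : ∀ i j n m k → 0 < k → k ≤ 10 → 78 ≤ n → Occ w i j n m k k → ⊥
no-long-Occ i j n m k 0<k k≤10 78≤n o = case 40 ≤? m of λ where
    (yes 40≤m) → no-long-pair i j n m k 0<k k≤10 78≤n 40≤m o
    (no 40≰m) → no-long-square i n (k + m + k) (≤-trans 0<k (m≤n+m k (k + m)))
      (+-mono-≤ (+-mono-≤ k≤10 (s≤s⁻¹ (≰⇒> 40≰m))) k≤10) 78≤n (subst (λ □ → Match w i □ n) (gap-assoc i n k m) (Occ.xx₁ o))
  where
  gap-assoc : ∀ i n k m → i + (n + k + m + k) ≡ i + n + 0 + (k + m + k)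
  gap-assoc = solve-∀

abstract
  oriented-trie : ∃ λ T → ∀ i → oriented T (i % 139 , win w i 11) ≡ true
  oriented-trie = trie (Binary.windows 11 pairs) , λ i → Binary.all-windows 11 pairs 2 (oriented (trie (Binary.windows 11 pairs))) (≤ᵇ⇒≤ 150 279 tt)
    (certify oriented (Binary.windows 11 pairs) (trie (Binary.windows 11 pairs)) refl) i (pairs-cover (i / 139))

  -- The descent handles lengths from 78 on, so x and z have at most 77 letters here. Then 174 = 77
  -- + 10 + 77 + 10 bounds the period and 251 = 77 + 174 the length of a fragment; three blocks hold
  -- such a window, as 138 + 251 ≤ 417.
  avoiding-trie : ∃ λ T → ∀ i → avoidingWindow 174 10 T (i % 139 , win w i 251) ≡ true
  avoiding-trie = trie (Binary.windows 251 triples) , λ i → Binary.all-windows 251 triples 3 (avoidingWindow 174 10 (trie (Binary.windows 251 triples))) (≤ᵇ⇒≤ 390 418 tt)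
    (certify (avoidingWindow 174 10) (Binary.windows 251 triples) (trie (Binary.windows 251 triples)) refl) i (triples-cover (i / 139))

theorem2 : ∃ λ (w : InfWord) → Avoids w F1 × Avoids w F2 × Avoids w F3 × Avoids w F4 × Avoids w F5
theorem2 = w ,
  -- The first y is plain in all five formulas. The three Booleans are the signs of the second y of
  -- the first fragment and of the two in the second fragment, `true` standing for reversal.
  (λ { h (ne , (i , o₁) ∷ (j , o₂) ∷ []) → refute h ne false false true refl i j o₁ o₂ }) ,
  (λ { h (ne , (i , o₁) ∷ (j , o₂) ∷ []) → refute h ne false true false refl i j o₁ o₂ }) ,
  (λ { h (ne , (i , o₁) ∷ (j , o₂) ∷ []) → refute h ne false true true refl i j o₁ o₂ }) ,
  (λ { h (ne , (i , o₁) ∷ (j , o₂) ∷ []) → refute h ne true false true refl i j o₁ o₂ }) ,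
  (λ { h (ne , (i , o₁) ∷ (j , o₂) ∷ []) → refute h ne true true false refl i j o₁ o₂ })
  where
  refute : (h : Defs.Assignment) → Defs.NonEmptyAssignment h → ∀ s₂ s₃ s₄ → s₂ ∨ s₃ ∨ s₄ ≡ true → ∀ i j →
    OccursAt w i (h Defs.x ++ h Defs.y ++ h Defs.z ++ sg s₂ (h Defs.y) ++ h Defs.x ++ []) →
    OccursAt w j (h Defs.z ++ sg s₃ (h Defs.y) ++ h Defs.x ++ sg s₄ (h Defs.y) ++ h Defs.z ++ []) → ⊥
  refute h ne s₂ s₃ s₄ mixed i j = Fragments.no-fragments w (_% 139) 10 77 174 251 (≤ᵇ⇒≤ 174 174 tt) (≤ᵇ⇒≤ 251 251 tt)
    oriented-trie avoiding-trie no-long-Occ (h Defs.x) (h Defs.z) (h Defs.y) s₂ s₃ s₄ i j mixed (ne Defs.x) (ne Defs.z) (ne Defs.y)
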